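{- Let $n \geq 1$ be a positive integer. There exists a graph $G$ that is $\chi_{ig}^{A}$-lower-game-vertex-critical and $\chi_{ig}^{AB}$-lower-game-vertex-critical, such that $\chi_{ig}^{A}(G)-\chi_{ig}^{A}(G-x)=n$ and $\chi_{ig}^{AB}(G)-\chi_{ig}^{AB}(G-x)=n$ for every vertex $x \in V(G)$.
   Context: All graphs are simple, undirected and finite. The independence coloring game on a graph $G$ is played by Alice and Bob in rounds, round $i$ being played with color $i$ ($i=1,2,\ldots$). Within a round the players alternate moves, each move consisting of coloring a previously uncolored vertex with the color of the round so that the vertices colored in the same round form an independent set. A round is completed when no uncolored vertex can be given the color of the round (every uncolored vertex is adjacent to a vertex colored in this round). The game is over when all vertices are colored. Alice wants to finish in as few rounds as possible, Bob in as many rounds as possible. In the A-independence coloring game every round is started by Alice; the number of rounds when both players play optimally is the A-independence game chromatic number $\chi_{ig}^{A}(G)$. In the AB-independence coloring game Alice starts the first round and each further round is started by the player who did not make the last move of the previous round; the number of rounds when both players play optimally is the AB-independence game chromatic number $\chi_{ig}^{AB}(G)$. For $x\in V(G)$, $G-x$ is the graph obtained from $G$ by deleting $x$ and all edges incident with $x$. For $\varphi\in\{\chi_{ig}^{A},\chi_{ig}^{AB}\}$, a graph $G$ is $\varphi$-lower-game-vertex-critical if $\varphi(G-x)<\varphi(G)$ for every $x\in V(G)$. -}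

module Defs where

open import Data.Fin.Base using (Fin; punchIn)
open import Data.Fin.Properties using (all?)
open import Data.List.Base using (List; []; _∷_; allFin; filter; map)
open import Data.List.Extrema.Nat using (min; max)
open import Data.Maybe.Base using (Maybe; nothing; just)
open import Data.Maybe.Properties using (≡-dec)
open import Data.Nat.Base using (ℕ; zero; suc; _<_)
import Data.Nat.Properties as ℕ
open import Data.Product.Base using (_×_)
open import Data.Vec.Base using (Vec; lookup; replicate; _[_]≔_)
open import Function.Base using (const; _on_)
open import Level using (0ℓ)
open import Relation.Binary.Core using (Rel)
open import Relation.Binary.Definitions using (Decidable; Irreflexive; Symmetric)
open import Relation.Binary.PropositionalEquality using (_≡_; refl)
open import Relation.Nullary using (¬_; Dec)
open import Relation.Nullary.Decidable using (¬?; _×-dec_; _→-dec_)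

record Graph (n : ℕ) : Set₁ where
  field
    _~_      : Rel (Fin n) 0ℓ
    ~-irrefl : Irreflexive _≡_ _~_
    ~-sym    : Symmetric _~_
    _~?_     : Decidable _~_

infixl 6 _-_

_-_ : ∀ {n} → Graph (suc n) → Fin (suc n) → Graph n
G - x = record
  { _~_      = _~_ on punchIn x
  ; ~-irrefl = λ { refl → ~-irrefl refl }
  ; ~-sym    = ~-sym
  ; _~?_     = λ u v → punchIn x u ~? punchIn x v
  }
  where open Graph G

data Player : Set where
  alice bob : Player

opponent : Player → Player
opponent alice = bob
opponent bob   = alice

Coloring : ℕ → Set
Coloring n = Vec (Maybe ℕ) n

-- The list is nonempty in every position reached in the game.
optimum : Player → List ℕ → ℕ
optimum _     []       = 0
optimum alice (x ∷ xs) = min x xs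
optimum bob   (x ∷ xs) = max x xs

-- `starter p` is the player who starts the next round when p has made the
-- last move of the current one.
module Game (starter : Player → Player) {n : ℕ} (G : Graph n) where

  open Graph G

  Legal : Coloring n → ℕ → Fin n → Set
  Legal c i v = lookup c v ≡ nothing × (∀ w → lookup c w ≡ just i → ¬ v ~ w)

  legal? : ∀ c i v → Dec (Legal c i v)
  legal? c i v =
    ≡-dec ℕ._≟_ (lookup c v) nothing
      ×-dec all? λ w → ≡-dec ℕ._≟_ (lookup c w) (just i) →-dec ¬? (v ~? w)

  moves : Coloring n → ℕ → List (Fin n)
  moves c i = filter (legal? c i) (allFin n)

  -- Minimax values: the number of rounds still to be started under optimal
  -- play, from a position with coloring c in round i. The first argument is
  -- always the number of uncolored vertices, which drops by one at each move.

  -- Round i is about to be started by p, unless the game is over.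
  newRound  : ℕ → Coloring n → ℕ → Player → ℕ
  -- Player p is to move and has a legal move.
  turn      : ℕ → Coloring n → ℕ → Player → ℕ
  -- Player p has just moved.
  afterMove : ℕ → Coloring n → ℕ → Player → ℕ

  newRound zero    c i p = 0
  newRound (suc m) c i p = suc (turn (suc m) c i p)

  turn zero    c i p = 0  -- unreachable: no uncolored vertex is left
  turn (suc m) c i p =
    optimum p (map (λ v → afterMove m (c [ v ]≔ just i) i p) (moves c i))

  afterMove m c i p with moves c i
  ... | []    = newRound m c (suc i) (starter p)
  ... | _ ∷ _ = turn m c i (opponent p)

  value : ℕ
  value = newRound n (replicate n nothing) 1 alice

χᴬ : ∀ {n} → Graph n → ℕ
χᴬ = Game.value (const alice)

χᴬᴮ : ∀ {n} → Graph n → ℕ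
χᴬᴮ = Game.value opponent

LowerGameVertexCritical : (∀ {n} → Graph n → ℕ) → ∀ {n} → Graph (suc n) → Set
LowerGameVertexCritical φ G = ∀ x → φ (G - x) < φ G

{-# OPTIONS --safe #-}
-- The graph is the crown K_{m,m} minus a perfect matching, with m = n + 2.
-- Whenever Alice starts a round, Bob ends it at once by coloring the partner of
-- her vertex, so only one pair is used up and she also starts the next round:
-- m rounds are needed. If Bob answers otherwise, both moves lie on one side, the
-- round swallows that side, and a single further round suffices.
-- Once x is deleted, its partner is adjacent to the whole opposite side; opening
-- with it, Alice colors one side in the first round and finishes in two.
module Submission where

open import Data.Fin.Base using
  (Fin; zero; suc; combine; opposite; punchIn; punchOut; quotient; remainder)
open import Data.Fin.Properties using
  (_≟_; combine-remQuot; punchIn-punchOut; punchInᵢ≢i; remQuot-combine)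
open import Data.Integer.Base using (+_; _⊖_)
open import Data.List.Base using ([]; _∷_; allFin; map)
open import Data.List.Extrema.Nat using (max≤v⁺; min≤v⁺; v≤max⁺; v≤min⁺)
open import Data.List.Membership.Propositional using (_∈_; lose)
open import Data.List.Membership.Propositional.Properties using
  (∈-allFin; ∈-map⁺; ∈-filter⁺; ∈-filter⁻)
open import Data.List.Relation.Unary.All as All using (All; []; _∷_)
import Data.List.Relation.Unary.All.Properties as All
open import Data.List.Relation.Unary.Any as Any using (Any; here; there)
import Data.List.Relation.Unary.Any.Properties as Any
open import Data.Maybe.Base using (just; nothing)
open import Data.Nat.Base using (ℕ; zero; suc; _*_; _<_; _≤_; _≥_; s≤s; z≤n)
open import Data.Nat.Properties using
  (<-irrefl; ≤-antisym; ≤-reflexive; ≤-trans; m<n⇒m<1+n; suc-injective)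
open import Data.Product.Base using (_×_; _,_; Σ-syntax; ∃-syntax; proj₁; proj₂)
open import Data.Sum.Base using (_⊎_; [_,_]′; inj₁; inj₂)
open import Data.Vec.Base using (_∷_; []; lookup; replicate; _[_]≔_)
open import Data.Vec.Properties using (lookup-replicate; lookup∘update; lookup∘update′)
open import Function.Base using (const; _∘_)
open import Relation.Binary.PropositionalEquality using
  (_≡_; _≢_; refl; sym; trans; cong; cong₂; subst; ≢-sym)
open import Relation.Nullary using (¬_; yes; no; contradiction)
open import Relation.Nullary.Decidable using (¬?; _×-dec_)
open import Defs

-- Bounds on minimax values over lists of outcomes

optimum-≤ : ∀ p {k xs} → All (_≤ k) xs → optimum p xs ≤ k
optimum-≤ _     []                    = z≤n
optimum-≤ alice {xs = x ∷ xs} (b ∷ _) = min≤v⁺ x xs (inj₁ b)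
optimum-≤ bob   (b ∷ bs)              = max≤v⁺ b bs

-- Membership rules out the empty list, whose default value `0` would violate every positive lower
-- bound.
optimum-≥ : ∀ p {k x xs} → x ∈ xs → All (k ≤_) xs → k ≤ optimum p xs
optimum-≥ alice _               (b ∷ bs) = v≤min⁺ b bs
optimum-≥ bob   {xs = x ∷ xs} _ (b ∷ _)  = v≤max⁺ x xs (inj₁ b)

optimum-alice-≤ : ∀ {k} xs → Any (_≤ k) xs → optimum alice xs ≤ k
optimum-alice-≤ (x ∷ xs) (here b)   = min≤v⁺ x xs (inj₁ b)
optimum-alice-≤ (x ∷ xs) (there bs) = min≤v⁺ x xs (inj₂ bs)

optimum-bob-≥ : ∀ {k} xs → Any (k ≤_) xs → k ≤ optimum bob xs
optimum-bob-≥ (x ∷ xs) (here b)   = v≤max⁺ x xs (inj₁ b)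
optimum-bob-≥ (x ∷ xs) (there bs) = v≤max⁺ x xs (inj₂ bs)

-- Uncolored vertices and the effect of one move

Free : ∀ {n} → Coloring n → Fin n → Set
Free c v = lookup c v ≡ nothing

-- Ties the counter in the game functions to the position: `uncolored c ≡ m` is carried along in the
-- inductions on `m`.
uncolored : ∀ {n} → Coloring n → ℕ
uncolored []            = 0
uncolored (nothing ∷ c) = suc (uncolored c)
uncolored (just _  ∷ c) = uncolored c

uncolored-replicate : ∀ n → uncolored (replicate n nothing) ≡ n
uncolored-replicate zero    = refl
uncolored-replicate (suc n) = cong suc (uncolored-replicate n)

uncolored-update : ∀ {n} (c : Coloring n) {v i} → Free c v →
  uncolored c ≡ suc (uncolored (c [ v ]≔ just i))
uncolored-update (nothing ∷ c) {zero}  _    = refl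
uncolored-update (nothing ∷ c) {suc v} free = cong suc (uncolored-update c free)
uncolored-update (just _  ∷ c) {suc v} free = uncolored-update c free

noFree⇒uncolored≡0 : ∀ {n} (c : Coloring n) → (∀ v → ¬ Free c v) → uncolored c ≡ 0
noFree⇒uncolored≡0 []            _    = refl
noFree⇒uncolored≡0 (nothing ∷ c) none = contradiction refl (none zero)
noFree⇒uncolored≡0 (just _  ∷ c) none = noFree⇒uncolored≡0 c (none ∘ suc)

uncolored≡suc⇒someFree : ∀ {n} (c : Coloring n) {m} → uncolored c ≡ suc m → ∃[ v ] Free c v
uncolored≡suc⇒someFree (nothing ∷ c) _ = zero , refl
uncolored≡suc⇒someFree (just _  ∷ c) e with uncolored≡suc⇒someFree c e
... | v , free = suc v , free

uncolored≡0⇒colored : ∀ {n} (c : Coloring n) → uncolored c ≡ 0 →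
  ∀ v → ∃[ k ] lookup c v ≡ just k
uncolored≡0⇒colored (just k ∷ c) _  zero    = k , refl
uncolored≡0⇒colored (just _ ∷ c) e  (suc v) = uncolored≡0⇒colored c e v

module _ {n : ℕ} (c : Coloring n) (v : Fin n) {i : ℕ} where

  free-update⁻ : ∀ w → Free (c [ v ]≔ just i) w → w ≢ v × Free c w
  free-update⁻ w free with w ≟ v
  ... | yes refl = contradiction (trans (sym (lookup∘update v c _)) free) λ ()
  ... | no w≢v   = w≢v , trans (sym (lookup∘update′ w≢v c _)) free

  free-update⁺ : ∀ {w} → w ≢ v → Free c w → Free (c [ v ]≔ just i) w
  free-update⁺ w≢v free = trans (lookup∘update′ w≢v c _) free

  colored-update⁻ : ∀ w {k} → lookup (c [ v ]≔ just i) w ≡ just k →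
    (w ≡ v × k ≡ i) ⊎ lookup c w ≡ just k
  colored-update⁻ w e with w ≟ v
  ... | no w≢v   = inj₂ (trans (sym (lookup∘update′ w≢v c _)) e)
  ... | yes refl with refl ← trans (sym (lookup∘update v c _)) e = inj₁ (refl , refl)

  colored-update⁺ : ∀ w {k} → Free c v → lookup c w ≡ just k →
    lookup (c [ v ]≔ just i) w ≡ just k
  colored-update⁺ w free e with w ≟ v
  ... | yes refl = contradiction (trans (sym free) e) λ ()
  ... | no w≢v   = trans (lookup∘update′ w≢v c _) e

-- At the start of round `i` the bound is `i`, so the color `i` is fresh; during the round the bound
-- is `suc i`, so the next color is fresh.
ColorsBelow : ∀ {n} → Coloring n → ℕ → Set
ColorsBelow c i = ∀ w {k} → lookup c w ≡ just k → k < i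

colorsBelow-update : ∀ {n} (c : Coloring n) v {i} →
  ColorsBelow c (suc i) → ColorsBelow (c [ v ]≔ just i) (suc i)
colorsBelow-update c v below w e with colored-update⁻ c v w e
... | inj₁ (_ , k≡i) = ≤-reflexive (cong suc k≡i)
... | inj₂ e′        = below w e′

opposite-≢ : (s : Fin 2) → opposite s ≢ s
opposite-≢ zero       ()
opposite-≢ (suc zero) ()

≢⇒≡opposite : ∀ {s t : Fin 2} → s ≢ t → s ≡ opposite t
≢⇒≡opposite {zero}     {zero}     s≢t = contradiction refl s≢t
≢⇒≡opposite {zero}     {suc zero} _   = refl
≢⇒≡opposite {suc zero} {zero}     _   = refl
≢⇒≡opposite {suc zero} {suc zero} s≢t = contradiction refl s≢t

-- Reasoning about positions in an arbitrary game

module GameProperties (starter : Player → Player) {n : ℕ} (G : Graph n) where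

  open Graph G
  open Game starter G

  empty : Coloring n
  empty = replicate n nothing

  empty-free : ∀ v → Free empty v
  empty-free v = lookup-replicate v nothing

  empty-uncolored : ∀ v {k} → lookup empty v ≢ just k
  empty-uncolored v e = contradiction (trans (sym (empty-free v)) e) λ ()

  empty-legal : ∀ {i} v → Legal empty i v
  empty-legal v = empty-free v , λ w e → contradiction e (empty-uncolored w)

  legal⇒∈moves : ∀ c i {v} → Legal c i v → v ∈ moves c i
  legal⇒∈moves c i {v} legal = ∈-filter⁺ (legal? c i) (∈-allFin v) legal

  ∈moves⇒legal : ∀ c i {v} → v ∈ moves c i → Legal c i v
  ∈moves⇒legal c i v∈ = proj₂ (∈-filter⁻ (legal? c i) {xs = allFin n} v∈)

  -- Within a round, moves only remove options, so restrictions on legal moves persist.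
  legal-update⁻ : ∀ c v {i} u → Free c v → Legal (c [ v ]≔ just i) i u → Legal c i u
  legal-update⁻ c v u free (free-u , indep) =
    proj₂ (free-update⁻ c v u free-u) , λ w e → indep w (colored-update⁺ c v w free e)

  uncolored-legal : ∀ c v {i m} → Legal c i v → uncolored c ≡ suc m →
    uncolored (c [ v ]≔ just i) ≡ m
  uncolored-legal c v legal e =
    suc-injective (trans (sym (uncolored-update c (proj₁ legal))) e)

  -- Case split on whether the round ends, for an arbitrary predicate, so that it serves upper
  -- bounds, lower bounds and equalities alike.
  afterMove-elim : ∀ (P : ℕ → Set) {m c i p} →
    ((∀ v → ¬ Legal c i v) → P (newRound m c (suc i) (starter p))) →
    (∀ v → Legal c i v → P (turn m c i (opponent p))) →
    P (afterMove m c i p)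
  afterMove-elim P {m} {c} {i} {p} over continue
    -- Both membership facts are abstracted together with `moves c i`, so that they speak about the
    -- matched list.
    with moves c i | legal⇒∈moves c i | ∈moves⇒legal c i
  ... | []    | legal⇒∈ | _       = over λ v legal → contradiction (legal⇒∈ legal) λ ()
  ... | v ∷ _ | _       | ∈⇒legal = continue v (∈⇒legal (here refl))

  newRound-≤ : ∀ m {c i p k} → turn m c i p ≤ k → newRound m c i p ≤ suc k
  newRound-≤ zero    _ = z≤n
  newRound-≤ (suc m) b = s≤s b

  module _ {m : ℕ} {c : Coloring n} {i k : ℕ} where

    outcome : Player → Fin n → ℕ
    outcome p v = afterMove m (c [ v ]≔ just i) i p

    turn-≤ : ∀ {p} → (∀ v → Legal c i v → outcome p v ≤ k) → turn (suc m) c i p ≤ k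
    turn-≤ {p} bound = optimum-≤ p (All.map⁺ {f = outcome p}
      (All.tabulate λ {v} v∈ → bound v (∈moves⇒legal c i v∈)))

    turn-≥ : ∀ {p} v → Legal c i v → (∀ w → Legal c i w → k ≤ outcome p w) →
      k ≤ turn (suc m) c i p
    turn-≥ {p} v legal bound = optimum-≥ p (∈-map⁺ (outcome p) (legal⇒∈moves c i legal))
      (All.map⁺ (All.tabulate λ {w} w∈ → bound w (∈moves⇒legal c i w∈)))

    -- Alice minimizes, so one good move of hers suffices; `turn-bob-≥` is the dual for Bob.
    turn-alice-≤ : ∀ v → Legal c i v → outcome alice v ≤ k → turn (suc m) c i alice ≤ k
    turn-alice-≤ v legal bound =
      optimum-alice-≤ (map (outcome alice) (moves c i))
        (Any.map⁺ (lose (legal⇒∈moves c i legal) bound))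

    turn-bob-≥ : ∀ v → Legal c i v → k ≤ outcome bob v → k ≤ turn (suc m) c i bob
    turn-bob-≥ v legal bound =
      optimum-bob-≥ (map (outcome bob) (moves c i))
        (Any.map⁺ (lose (legal⇒∈moves c i legal) bound))

  -- A graph with an edge needs two rounds

  module Edge {u v : Fin n} (u~v : u ~ v) where

    OnlyColor1 : Coloring n → Set
    OnlyColor1 c = (∀ w {k} → lookup c w ≡ just k → k ≡ 1)
      × (∀ a b → lookup c a ≡ just 1 → lookup c b ≡ just 1 → ¬ a ~ b)

    onlyColor1-update : ∀ c w → OnlyColor1 c → Legal c 1 w → OnlyColor1 (c [ w ]≔ just 1)
    onlyColor1-update c w (one , indep) (_ , indep-w) = one′ , indep′
      where
      one′ : ∀ x {k} → lookup (c [ w ]≔ just 1) x ≡ just k → k ≡ 1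
      one′ x e with colored-update⁻ c w x e
      ... | inj₁ (_ , k≡1) = k≡1
      ... | inj₂ e′        = one x e′
      indep′ : ∀ a b → lookup (c [ w ]≔ just 1) a ≡ just 1 →
        lookup (c [ w ]≔ just 1) b ≡ just 1 → ¬ a ~ b
      indep′ a b ea eb with colored-update⁻ c w a ea | colored-update⁻ c w b eb
      ... | inj₁ (refl , _) | inj₁ (refl , _) = ~-irrefl refl
      ... | inj₁ (refl , _) | inj₂ eb′        = indep-w b eb′
      ... | inj₂ ea′        | inj₁ (refl , _) = indep-w a ea′ ∘ ~-sym
      ... | inj₂ ea′        | inj₂ eb′        = indep a b ea′ eb′

    -- Otherwise both ends of the edge `u ~ v` would have color 1, against independence.
    onlyColor1⇒uncolored≢0 : ∀ c → OnlyColor1 c → uncolored c ≢ 0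
    onlyColor1⇒uncolored≢0 c (one , indep) e
      with uncolored≡0⇒colored c e u | uncolored≡0⇒colored c e v
    ... | k , eu | l , ev with refl ← one u eu | refl ← one v ev = indep u v eu ev u~v

    -- Round 1 never colors everything, so whenever it ends, a second round is started and counted.
    afterMove-≥1 : ∀ m c {p} → OnlyColor1 c → uncolored c ≡ m → 1 ≤ afterMove m c 1 p
    afterMove-≥1 zero    c only e = contradiction e (onlyColor1⇒uncolored≢0 c only)
    afterMove-≥1 (suc m) c only e = afterMove-elim (1 ≤_) (λ _ → s≤s z≤n) λ v legal →
      turn-≥ v legal λ w legal-w →
        afterMove-≥1 m _ (onlyColor1-update c w only legal-w) (uncolored-legal c w legal-w e)

    empty-onlyColor1 : OnlyColor1 empty
    empty-onlyColor1 =
        (λ w e → contradiction e (empty-uncolored w))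
      , (λ a _ e → contradiction e (empty-uncolored a))

    newRound-≥2 : ∀ m {p} → uncolored empty ≡ m → 2 ≤ newRound m empty 1 p
    newRound-≥2 zero    e = contradiction e (onlyColor1⇒uncolored≢0 empty empty-onlyColor1)
    newRound-≥2 (suc m) e = s≤s (turn-≥ u (empty-legal u) λ w legal →
      afterMove-≥1 m _ (onlyColor1-update empty w empty-onlyColor1 legal)
        (uncolored-legal empty w legal e))

    value-≥2 : 2 ≤ value
    value-≥2 = newRound-≥2 n (uncolored-replicate n)

  -- Rounds confined to one side of a bipartite graph

  module Bipartite (side : Fin n → Fin 2) (proper : ∀ {u v} → u ~ v → side u ≢ side v) where

    ClassWithin : Coloring n → ℕ → Fin 2 → Set
    ClassWithin c i s = ∀ w → lookup c w ≡ just i → side w ≡ s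

    classWithin-update : ∀ c v {i s} → ClassWithin c i s → side v ≡ s →
      ClassWithin (c [ v ]≔ just i) i s
    classWithin-update c v class v≡s w e with colored-update⁻ c v w e
    ... | inj₁ (refl , _) = v≡s
    ... | inj₂ e′         = class w e′

    free⇒legal : ∀ c u {i s} → ClassWithin c i s → Free c u → side u ≡ s → Legal c i u
    free⇒legal c u class free u≡s =
      free , λ w e u~w → proper u~w (trans u≡s (sym (class w e)))

    -- No vertex of side `s` blocks another, so the round colors all that is left. The bound is 0
    -- because `turn` does not count the current round.
    turn-lastSide : ∀ m {c i p s} → (∀ u → Free c u → side u ≡ s) → ClassWithin c i s →
      uncolored c ≡ m → turn m c i p ≤ 0
    turn-lastSide zero    _ _ _ = z≤n
    turn-lastSide (suc m) {c} {i} within class e = turn-≤ λ v legal →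
      let c′      = c [ v ]≔ just i
          within′ = λ u free → within u (proj₂ (free-update⁻ c v u free))
          class′  = classWithin-update c v class (within v (proj₁ legal))
          e′      = uncolored-legal c v legal e
      in afterMove-elim (_≤ 0)
        -- The round ends only when nothing is free; then `m` is 0 and `newRound` starts no further
        -- round.
        (λ none → subst (λ m → newRound m c′ (suc i) _ ≤ 0)
          (trans (sym (noFree⇒uncolored≡0 c′ λ u free →
            none u (free⇒legal c′ u class′ free (within′ u free)))) e′)
          z≤n)
        (λ _ _ → turn-lastSide m within′ class′ e′)

    -- The rest of round i is then played on side s, and exhausts it.
    Confined : Coloring n → ℕ → Fin 2 → Set
    Confined c i s = ClassWithin c i s × (∀ u → Legal c i u → side u ≡ s)

    -- When the round ends, side `s` is fully colored, since a free vertex there would be legal. One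
    -- more round finishes the other side.
    afterMove-confined-≤1 : ∀ m {c i p s} → Confined c i s → ColorsBelow c (suc i) →
      uncolored c ≡ m → afterMove m c i p ≤ 1
    afterMove-confined-≤1 m {c} {i} {p} {s} (class , confined) below e =
      afterMove-elim (_≤ 1) over (continue m e)
      where
      over : (∀ v → ¬ Legal c i v) → newRound m c (suc i) (starter p) ≤ 1
      over none = newRound-≤ m (turn-lastSide m
        (λ u free → ≢⇒≡opposite λ u≡s → none u (free⇒legal c u class free u≡s))
        (λ w e → contradiction (below w e) (<-irrefl refl)) e)
      continue : ∀ m → uncolored c ≡ m → ∀ v → Legal c i v → turn m c i (opponent p) ≤ 1
      continue zero    _ _ _ = z≤n
      continue (suc m) e _ _ = turn-≤ λ v legal → afterMove-confined-≤1 m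
        ( classWithin-update c v class (confined v legal)
        , λ u → confined u ∘ legal-update⁻ c v u (proj₁ legal))
        (colorsBelow-update c v below) (uncolored-legal c v legal e)

    value-≤2 : ∀ y → (∀ u → side u ≢ side y → u ~ y) → value ≤ 2
    value-≤2 y dominates = newRound-≤ n (start n (uncolored-replicate n))
      where
      confined : ∀ u → Legal (empty [ y ]≔ just 1) 1 u → side u ≡ side y
      confined u (_ , indep) with side u ≟ side y
      ... | yes u≡y = u≡y
      ... | no  u≢y =
        contradiction (dominates u u≢y) (indep y (lookup∘update y empty (just 1)))
      start : ∀ m → uncolored empty ≡ m → turn m empty 1 alice ≤ 1
      start zero    _ = z≤n
      start (suc m) e = turn-alice-≤ y (empty-legal y) (afterMove-confined-≤1 m
        ( classWithin-update empty y (λ w e → contradiction e (empty-uncolored w)) refl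
        , confined)
        (colorsBelow-update empty y λ w e → contradiction e (empty-uncolored w))
        (uncolored-legal empty y (empty-legal y) e))

-- The crown graph

module Crown (m : ℕ) where

  -- Vertices are numbered pair by pair: division by 2 gives the pair as quotient and the side as
  -- remainder.
  pair : Fin (m * 2) → Fin m
  pair = quotient 2

  side : Fin (m * 2) → Fin 2
  side = remainder {m} 2

  crown : Graph (m * 2)
  crown = record
    { _~_      = λ u v → pair u ≢ pair v × side u ≢ side v
    ; ~-irrefl = λ { refl (p≢p , _) → p≢p refl }
    ; ~-sym    = λ { (p , s) → ≢-sym p , ≢-sym s }
    ; _~?_     = λ u v → ¬? (pair u ≟ pair v) ×-dec ¬? (side u ≟ side v)
    }

  vertex-≡ : ∀ {u v} → pair u ≡ pair v → side u ≡ side v → u ≡ v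
  vertex-≡ {u} {v} p s = trans (sym (combine-remQuot {m} 2 u))
    (trans (cong₂ combine p s) (combine-remQuot {m} 2 v))

  partner : Fin (m * 2) → Fin (m * 2)
  partner v = combine (pair v) (opposite (side v))

  pair-partner : ∀ v → pair (partner v) ≡ pair v
  pair-partner v = cong proj₁ (remQuot-combine (pair v) _)

  side-partner : ∀ v → side (partner v) ≡ opposite (side v)
  side-partner v = cong proj₂ (remQuot-combine (pair v) _)

  partner-≢ : ∀ v → partner v ≢ v
  partner-≢ v e = opposite-≢ (side v) (trans (sym (side-partner v)) (cong side e))

  same-pair : ∀ {u v} → pair u ≡ pair v → u ≡ v ⊎ u ≡ partner v
  same-pair {u} {v} p
    with side u | side v | side-partner v
       -- These two implications are generalized along with the sides, so that each case needs only
       -- an equation between concrete sides.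
       | vertex-≡ {u} {v} p | vertex-≡ {u} {partner v} (trans p (sym (pair-partner v)))
  ... | zero     | zero     | _ | f | _ = inj₁ (f refl)
  ... | suc zero | suc zero | _ | f | _ = inj₁ (f refl)
  ... | zero     | suc zero | e | _ | g = inj₂ (g (sym e))
  ... | suc zero | zero     | e | _ | g = inj₂ (g (sym e))

  -- The number of rounds on the crown

  module CrownGame (starter : Player → Player) (bob⇒alice : starter bob ≡ alice) where

    open Graph crown
    open Game starter crown
    open GameProperties starter crown
    open Bipartite side proj₂

    -- Says that the free vertices induce a smaller crown; this is the invariant at the start of
    -- rounds in the induction.
    Paired : Coloring (m * 2) → Set
    Paired c = ∀ v → Free c v → Free c (partner v)

    -- Induction on the number `j` of free pairs. Alice's opening is immaterial for both bounds: the
    -- upper one covers every reply of Bob, the lower one uses the partner reply.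
    newRound-paired : ∀ j {c i} → Paired c → ColorsBelow c i → uncolored c ≡ j * 2 →
      newRound (j * 2) c i alice ≡ j
    newRound-paired zero    _ _ _ = refl
    newRound-paired (suc j) {c} {i} paired below e = cong suc (≤-antisym
      (turn-≤ λ v legal → afterMove-elim (_≤ j)
        -- The round cannot end after Alice's first move, since the partner of her vertex is still
        -- legal.
        (λ none → contradiction (partner-legal v legal) (none (partner v)))
        (λ _ _ → turn-≤ λ w legal-w → reply-≤ v legal w legal-w))
      (turn-≥ _ (free⇒legal-c (proj₂ (uncolored≡suc⇒someFree c e))) λ v legal →
        afterMove-elim (j ≤_)
        (λ none → contradiction (partner-legal v legal) (none (partner v)))
        (λ _ _ → turn-bob-≥ (partner v) (partner-legal v legal)
          (≤-reflexive (sym (reply-partner v legal))))))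
      where
      c₁ : Fin (m * 2) → Coloring (m * 2)
      c₁ v = c [ v ]≔ just i

      c₂ : Fin (m * 2) → Fin (m * 2) → Coloring (m * 2)
      c₂ v w = c₁ v [ w ]≔ just i

      unused : ∀ w → lookup c w ≢ just i
      unused w e = <-irrefl refl (below w e)

      below′ : ∀ v w → ColorsBelow (c₂ v w) (suc i)
      below′ v w = colorsBelow-update (c₁ v) w (colorsBelow-update c v
        λ w e → m<n⇒m<1+n (below w e))

      free⇒legal-c : ∀ {v} → Free c v → Legal c i v
      free⇒legal-c free = free , λ w e → contradiction e (unused w)

      partner-legal : ∀ v → Legal c i v → Legal (c₁ v) i (partner v)
      partner-legal v (free , _) = free-update⁺ c v (partner-≢ v) (paired v free) , indep
        where
        indep : ∀ w → lookup (c₁ v) w ≡ just i → ¬ partner v ~ w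
        indep w e (p≢ , _) with colored-update⁻ c v w e
        ... | inj₁ (refl , _) = p≢ (pair-partner v)
        ... | inj₂ e′         = unused w e′

      module _ (v : Fin (m * 2)) (legal : Legal c i v) where

        c₁-v : lookup (c₁ v) v ≡ just i
        c₁-v = lookup∘update v c (just i)

        e₁ : uncolored (c₁ v) ≡ suc (j * 2)
        e₁ = uncolored-legal c v legal e

        c₂-free : ∀ w → Free (c₂ v (partner v)) w → pair w ≢ pair v × Free c w
        c₂-free w free with free-update⁻ (c₁ v) (partner v) w free
        ... | w≢p , free₁ with free-update⁻ c v w free₁
        ... | w≢v , free₀ = [ w≢v , w≢p ]′ ∘ same-pair , free₀

        reply-partner : afterMove (j * 2) (c₂ v (partner v)) i bob ≡ j
        reply-partner = afterMove-elim (_≡ j)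
          -- Bob has made the last move, so `bob⇒alice` lets Alice open the next round, as the
          -- induction hypothesis requires.
          (λ _ → trans (cong (newRound (j * 2) (c₂ v (partner v)) (suc i)) bob⇒alice)
            (newRound-paired j paired′ (below′ v (partner v))
              (uncolored-legal (c₁ v) (partner v) (partner-legal v legal) e₁)))
          (λ u legal-u → contradiction legal-u (noLegal u))
          where
          c₂-v : lookup (c₂ v (partner v)) v ≡ just i
          c₂-v = colored-update⁺ (c₁ v) (partner v) v (proj₁ (partner-legal v legal)) c₁-v

          paired′ : Paired (c₂ v (partner v))
          paired′ w free with c₂-free w free
          ... | w≢v , free₀ = free-update⁺ (c₁ v) (partner v)
            (λ p → w≢v (trans (sym (pair-partner w)) (trans (cong pair p) (pair-partner v))))
            (free-update⁺ c v (λ p → w≢v (trans (sym (pair-partner w)) (cong pair p)))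
              (paired w free₀))

          -- A vertex of another pair is adjacent to `v` or to its partner, according to its side.
          noLegal : ∀ u → ¬ Legal (c₂ v (partner v)) i u
          noLegal u (free , indep) with c₂-free u free | side u ≟ side v
          ... | u≢v , _ | no s≢s  = indep v c₂-v (u≢v , s≢s)
          ... | u≢v , _ | yes s≡s = indep (partner v) (lookup∘update (partner v) (c₁ v) _)
            ( (λ p → u≢v (trans p (pair-partner v)))
            , λ s → opposite-≢ (side v) (trans (sym (side-partner v)) (trans (sym s) s≡s)))

        -- A reply outside the pair of `v` is on the side of `v`. Together the two vertices block
        -- the whole opposite side, so at most one further round follows.
        reply-≤ : ∀ w → Legal (c₁ v) i w → afterMove (j * 2) (c₂ v w) i bob ≤ j
        reply-≤ w legal-w with w ≟ partner v
        ... | yes refl = ≤-reflexive reply-partner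
        ... | no w≢p = ≤-trans
          (afterMove-confined-≤1 (j * 2)
            (classWithin-update (c₁ v) w class-c₁ side≡ , confined)
            (below′ v w) (uncolored-legal (c₁ v) w legal-w e₁))
          (positive j (uncolored-legal (c₁ v) (partner v) (partner-legal v legal) e₁))
          where
          pair≢ : pair w ≢ pair v
          pair≢ = [ proj₁ (free-update⁻ c v w (proj₁ legal-w)) , w≢p ]′ ∘ same-pair

          nonadjacent⇒sameSide : ∀ {u x} → pair u ≢ pair x → ¬ u ~ x → side u ≡ side x
          nonadjacent⇒sameSide {u} {x} p ¬adj with side u ≟ side x
          ... | yes s = s
          ... | no s  = contradiction (p , s) ¬adj

          side≡ : side w ≡ side v
          side≡ = nonadjacent⇒sameSide pair≢ (proj₂ legal-w v c₁-v)

          class-c₁ : ClassWithin (c₁ v) i (side v)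
          class-c₁ = classWithin-update c v (λ u e → contradiction e (unused u)) refl

          confined : ∀ u → Legal (c₂ v w) i u → side u ≡ side v
          confined u (_ , indep) with pair u ≟ pair v
          ... | no u≢v  = nonadjacent⇒sameSide u≢v
            (indep v (colored-update⁺ (c₁ v) w v (proj₁ legal-w) c₁-v))
          -- Here `v` gives no information, as with its partner; `w` lies in another pair and
          -- decides the side.
          ... | yes u≡v = trans
            (nonadjacent⇒sameSide (λ p → pair≢ (trans (sym p) u≡v))
              (indep w (lookup∘update w (c₁ v) _)))
            side≡

          -- Had Bob taken the partner instead, `w` would still be free, so `j` is not 0.
          positive : ∀ j → uncolored (c₂ v (partner v)) ≡ j * 2 → 1 ≤ j
          positive (suc j) _ = s≤s z≤n
          positive zero    e with uncolored≡0⇒colored (c₂ v (partner v)) e w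
          ... | _ , eq = contradiction
            (trans (sym (free-update⁺ (c₁ v) (partner v) w≢p (proj₁ legal-w))) eq) λ ()

    value-crown : value ≡ m
    value-crown = newRound-paired m (λ v _ → empty-free (partner v))
      (λ w e → contradiction e (empty-uncolored w))
      (uncolored-replicate (m * 2))

-- Deleting a vertex leaves exactly two rounds

module CrownMinusVertex (starter : Player → Player) (n : ℕ) where

  open Crown (suc (suc n))

  module _ (x : Fin (suc (suc n) * 2)) where

    x≢partner : x ≢ partner x
    x≢partner = ≢-sym (partner-≢ x)

    y : Fin (suc (suc n * 2))
    y = punchOut x≢partner

    y≡partner : punchIn x y ≡ partner x
    y≡partner = punchIn-punchOut x≢partner

    -- The only vertex across from `y` and not adjacent to it was `x`, which is gone.
    dominates : ∀ u → side (punchIn x u) ≢ side (punchIn x y) → Graph._~_ (crown - x) u y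
    dominates u s = pair≢ , s
      where
      pair≢ : pair (punchIn x u) ≢ pair (punchIn x y)
      pair≢ p with same-pair (trans p (trans (cong pair y≡partner) (pair-partner x)))
      ... | inj₁ u≡x = punchInᵢ≢i x u u≡x
      ... | inj₂ u≡p = s (cong side (trans u≡p (sym y≡partner)))

    z : Fin (suc (suc n) * 2)
    -- `punchIn (pair x) zero` is a pair other than that of `x`; it exists because there are at
    -- least two pairs. Thus `z` survives and is a neighbor of `y`, giving an edge for the lower
    -- bound.
    z = combine (punchIn (pair x) zero) (side x)

    x≢z : x ≢ z
    x≢z e = punchInᵢ≢i (pair x) zero
      (trans (sym (cong proj₁ (remQuot-combine (punchIn (pair x) zero) (side x)))) (cong pair (sym e)))

    z≢y : side (punchIn x (punchOut x≢z)) ≢ side (punchIn x y)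
    z≢y e = opposite-≢ (side x) (trans (sym (side-partner x)) (trans (cong side (sym y≡partner))
      (trans (sym e) (trans (cong side (punchIn-punchOut x≢z))
        (cong proj₂ (remQuot-combine (punchIn (pair x) zero) (side x)))))))

    open GameProperties starter (crown - x)

    value-crown-minus : Game.value starter (crown - x) ≡ 2
    value-crown-minus = ≤-antisym
      (Bipartite.value-≤2 (side ∘ punchIn x) proj₂ y dominates)
      (Edge.value-≥2 (dominates (punchOut x≢z) z≢y))

proposition18 : ∀ (n : ℕ) → n ≥ 1 →
    ∃[ k ] Σ[ G ∈ Graph (suc k) ]
    (LowerGameVertexCritical χᴬ G
    × LowerGameVertexCritical χᴬᴮ G
    × (∀ x → χᴬ G ⊖ χᴬ (G - x) ≡ + n × χᴬᴮ G ⊖ χᴬᴮ (G - x) ≡ + n))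
-- The difference sought is `suc n`, so the crown has `suc n + 2` pairs; the witness is its number
-- of vertices less one.
proposition18 (suc n) _ = suc (suc (suc n) * 2) , crown ,
    (λ x → critical (before-A , after-A x))
  , (λ x → critical (before-AB , after-AB x))
  , λ x → difference (before-A , after-A x) , difference (before-AB , after-AB x)
  where
  open Crown (suc (suc (suc n)))

  before-A : χᴬ crown ≡ suc (suc (suc n))
  before-A = CrownGame.value-crown (const alice) refl

  before-AB : χᴬᴮ crown ≡ suc (suc (suc n))
  before-AB = CrownGame.value-crown opponent refl

  after-A : ∀ x → χᴬ (crown - x) ≡ 2
  after-A = CrownMinusVertex.value-crown-minus (const alice) (suc n)

  after-AB : ∀ x → χᴬᴮ (crown - x) ≡ 2
  after-AB = CrownMinusVertex.value-crown-minus opponent (suc n)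

  critical : ∀ {a b} → a ≡ suc (suc (suc n)) × b ≡ 2 → b < a
  critical (refl , refl) = s≤s (s≤s (s≤s z≤n))

  difference : ∀ {a b} → a ≡ suc (suc (suc n)) × b ≡ 2 → a ⊖ b ≡ + suc n
  difference (refl , refl) = refl
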